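{- Let $H$ be a finite simple graph with $n=|V(H)|\ge1$ vertices, chromatic number $\chi=\chi(H)$, and $m'(H)$ non-edges. Then $$\left\lceil \frac{n}{\chi} \right\rceil \left( n - \frac{\chi}{2}\left\lceil\frac{n}{\chi}-1\right\rceil\right) = n+m'(H)$$ holds if and only if $H$ is a Turán graph.
   Context: All graphs are finite and simple. A non-edge of $H$ is an unordered pair of distinct non-adjacent vertices. The Turán graph $T(n,r)$ is the complete $r$-partite graph on $n$ vertices whose $r$ classes have sizes as equal as possible (any two class sizes differ by at most one); a Turán graph is a graph isomorphic to some $T(n,r)$. -}

module Defs where

open import Data.Fin as Fin using (Fin; finToFun; funToFin)
open import Data.Fin.Permutation using (Permutation; _⟨$⟩ʳ_)
open import Data.Fin.Properties using (_≟_; _<?_; any?; all?; finToFun-funToFin)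
open import Data.List using (List; length; filter; allFin; cartesianProduct)
open import Data.Nat using (ℕ; zero; suc; NonZero; _+_; _^_; _≤_; _<_; ∣_-_∣)
open import Data.Nat.Properties using (+-identityʳ; +-suc; m<1+n⇒m<n∨m≡n)
open import Data.Product using (Σ-syntax; ∃; ∃-syntax; _×_; _,_; proj₁; proj₂)
open import Data.Sum using (inj₁; inj₂)
open import Function using (_⇔_; id)
open import Level using (0ℓ)
open import Relation.Binary using (Rel; Decidable; Symmetric; Irreflexive)
open import Relation.Binary.PropositionalEquality
  using (_≡_; _≢_; refl; sym; trans; subst)
open import Relation.Nullary using (¬_; Dec; yes; no)
open import Relation.Nullary.Decidable using (map′; ¬?; _→-dec_; _×-dec_)
import Relation.Unary as U

record Graph (n : ℕ) : Set₁ where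
  field
    _~_    : Rel (Fin n) 0ℓ
    _~?_   : Decidable _~_
    ~-sym  : Symmetric _~_
    ~-irr  : Irreflexive _≡_ _~_

infix 4 _≅_

_≅_ : ∀ {m n} → Graph m → Graph n → Set
_≅_ {m} {n} G H =
  Σ[ π ∈ Permutation m n ] (∀ u v → u G.~ v ⇔ (π ⟨$⟩ʳ u) H.~ (π ⟨$⟩ʳ v))
  where
  module G = Graph G
  module H = Graph H

-- Each unordered pair {u , v} is counted once, as the pair with u < v.
nonEdges : ∀ {n} → Graph n → List (Fin n × Fin n)
nonEdges {n} H =
  filter (λ (u , v) → (u <? v) ×-dec ¬? (u ~? v))
         (cartesianProduct (allFin n) (allFin n))
  where open Graph H

ProperColouring : ∀ {n k} → Graph n → (Fin n → Fin k) → Set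
ProperColouring H c = ∀ u v → u ~ v → c u ≢ c v
  where open Graph H

Colourable : ∀ {n} → Graph n → ℕ → Set
Colourable {n} H k = ∃[ c ] ProperColouring {n} {k} H c

properColouring? : ∀ {n k} (H : Graph n) (c : Fin n → Fin k) →
                   Dec (ProperColouring H c)
properColouring? H c =
  all? λ u → all? λ v → (u ~? v) →-dec ¬? (c u ≟ c v)
  where open Graph H

colourable? : ∀ {n} (H : Graph n) → U.Decidable (Colourable H)
colourable? {n} H k = map′
  (λ (i , p) → finToFun i , p)
  (λ (c , p) → funToFin c , λ u v u~v eq → p u v u~v
     (trans (sym (finToFun-funToFin c u)) (trans eq (finToFun-funToFin c v))))
  (any? λ (i : Fin (k ^ n)) → properColouring? {n} {k} H (finToFun i))

colourable-order : ∀ {n} (H : Graph n) → Colourable H n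
colourable-order H = id , λ u v u~v u≡v → Graph.~-irr H u≡v u~v

Least : (ℕ → Set) → ℕ → Set
Least P k = P k × (∀ j → j < k → ¬ P j)

least : ∀ {P : ℕ → Set} → U.Decidable P → ∀ {b} → P b → ∃ (Least P)
least {P} P? {b} Pb = search b 0 (λ _ ()) (subst P (sym (+-identityʳ b)) Pb)
  where
  search : ∀ d k → (∀ j → j < k → ¬ P j) → P (d + k) → ∃ (Least P)
  search zero    k below Pk = k , Pk , below
  search (suc d) k below Pd+k with P? k
  ... | yes Pk = k , Pk , below
  ... | no ¬Pk = search d (suc k) below′ (subst P (sym (+-suc d k)) Pd+k)
    where
    below′ : ∀ j → j < suc k → ¬ P j
    below′ j j<1+k Pj with m<1+n⇒m<n∨m≡n j<1+k
    ... | inj₁ j<k  = below j j<k Pj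
    ... | inj₂ refl = ¬Pk Pj

opaque
  chromaticNumber : ∀ {n} → Graph n → ℕ
  chromaticNumber H = proj₁ (least (colourable? H) (colourable-order H))

  chromaticNumber-least : ∀ {n} (H : Graph n) →
                          Least (Colourable H) (chromaticNumber H)
  chromaticNumber-least H = proj₂ (least (colourable? H) (colourable-order H))

colourable⇒nonZero : ∀ {n k} .{{_ : NonZero n}} {H : Graph n} →
                     Colourable H k → NonZero k
colourable⇒nonZero {suc n} {zero}  (c , _) with () ← c Fin.zero
colourable⇒nonZero {suc n} {suc k} _ = _

instance
  chromaticNumber-nonZero : ∀ {n} .{{_ : NonZero n}} {H : Graph n} →
                            NonZero (chromaticNumber H)
  chromaticNumber-nonZero {H = H} =
    colourable⇒nonZero {H = H} (proj₁ (chromaticNumber-least H))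

completeMultipartite : ∀ {n r} → (Fin n → Fin r) → Graph n
completeMultipartite c = record
  { _~_   = λ u v → c u ≢ c v
  ; _~?_  = λ u v → ¬? (c u ≟ c v)
  ; ~-sym = λ cu≢cv cv≡cu → cu≢cv (sym cv≡cu)
  ; ~-irr = λ { refl cu≢cu → cu≢cu refl }
  }

classSize : ∀ {n r} → (Fin n → Fin r) → Fin r → ℕ
classSize {n} c i = length (filter (λ v → c v ≟ i) (allFin n))

Balanced : ∀ {n r} → (Fin n → Fin r) → Set
Balanced c = ∀ i j → ∣ classSize c i - classSize c j ∣ ≤ 1

-- T(n,r) is determined only up to isomorphism: it is completeMultipartite c
-- for any balanced assignment c of the n vertices to r classes.  For r > n
-- some classes are empty and the graph is complete, i.e. T(n,n).
IsTurán : ∀ {n} → Graph n → Set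
IsTurán {n} H =
  ∃[ r ] Σ[ c ∈ (Fin n → Fin r) ] Balanced c × H ≅ completeMultipartite c

-- Put k + 1 = ⌈n/χ⌉ and let a₁, …, a_χ be the class sizes of an optimal
-- colouring.  Doubled, the equation reads
--   2(k+1) n = N + n + χ k(k+1),
-- where N = n + 2m′ counts the ordered pairs (u , v), u = v included, that are
-- not adjacent.  Here N ≥ Σ aᵢ², with equality iff H is complete multipartite
-- with the colour classes as parts, and 2(k+1) aᵢ ≤ aᵢ² + aᵢ + k(k+1), with
-- equality iff aᵢ ∈ {k , k+1}; summing over i, "≤" always holds and "=" holds
-- iff both equality conditions do.  Conversely, an optimal colouring of a
-- Turán graph has exactly its nonempty parts as classes, and averaging forces
-- their balanced sizes into {k , k+1}.

module Submission where

open import Defs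
open import Data.Empty using (⊥-elim)
open import Data.Fin as Fin using (Fin; punchOut)
import Data.Fin.Permutation as Perm
open import Data.Fin.Permutation using (_⟨$⟩ʳ_)
open import Data.Fin.Properties
  using (_≟_; _<?_; any?; punchOut-injective; <-cmp)
import Data.Integer as ℤ
open import Data.Integer using (ℤ; +_)
import Data.Integer.DivMod as ℤ
import Data.Integer.Properties as ℤ
import Data.Integer.Tactic.RingSolver as ℤ
open import Data.List using (length; filter; map; tabulate; cartesianProduct; _++_)
open import Data.List.Properties using (length-++; filter-++; map-tabulate)
open import Data.Nat as ℕ
  using (ℕ; zero; suc; NonZero; _≤_; _<_; z≤n; s≤s; ∣_-_∣)
import Data.Nat.DivMod as ℕ
import Data.Nat.Properties as ℕ
import Data.Nat.Tactic.RingSolver as ℕ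
open import Data.Product using (∃-syntax; _×_; _,_; proj₁; proj₂)
open import Data.Rational using (mkℚ; _/_; _*_; _+_; _-_; -_; 1ℚ; ceiling; toℚᵘ)
import Data.Rational as ℚ
import Data.Rational.Properties as ℚ
open import Data.Rational.Unnormalised as ℚᵘ using (ℚᵘ; mkℚᵘ; _≃_; *≡*)
import Data.Rational.Unnormalised.Properties as ℚᵘ
open import Data.Sum using (_⊎_; inj₁; inj₂)
open import Function using (_∘_; id; _⇔_; mk⇔; Equivalence; it)
open import Function.Construct.Composition using (_⇔-∘_)
open import Relation.Binary using (tri<; tri≈; tri>)
open import Relation.Binary.PropositionalEquality
  using (_≡_; _≢_; refl; sym; trans; cong; cong₂; subst; module ≡-Reasoning)
open import Relation.Nullary using (¬_; Dec; yes; no)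
open import Relation.Nullary.Decidable using (¬?; _×-dec_; decidable-stable)
import Relation.Unary as U

open import Algebra.Properties.AbelianGroup ℤ.+-0-abelianGroup using (∙-cancelʳ)
open import Algebra.Properties.Semiring.Sum ℕ.+-*-semiring
  using (sum; sum-cong-≗; ∑-distrib-+; ∑-comm; ∑-permute; *-distribʳ-sum)

-- Finite sums and indicators.

sum-const : ∀ n x → sum {n} (λ _ → x) ≡ n ℕ.* x
sum-const zero    x = refl
sum-const (suc n) x = cong (x ℕ.+_) (sum-const n x)

sum-mono-≤ : ∀ {n} {f g : Fin n → ℕ} → (∀ i → f i ≤ g i) → sum f ≤ sum g
sum-mono-≤ {zero}  f≤g = z≤n
sum-mono-≤ {suc n} f≤g = ℕ.+-mono-≤ (f≤g Fin.zero) (sum-mono-≤ (f≤g ∘ Fin.suc))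

-- Slack in one term cannot be made up by the others, as each of them is bounded in the same
-- direction. This turns equality of totals into equality term by term.
sum-mono-≤-tight : ∀ {n} {f g : Fin n → ℕ} → (∀ i → f i ≤ g i) →
                   sum g ≤ sum f → ∀ i → f i ≡ g i
sum-mono-≤-tight {suc n} {f} {g} f≤g Σg≤Σf = λ where
    Fin.zero    → ℕ.≤-antisym (f≤g Fin.zero)
      (ℕ.+-cancelʳ-≤ _ _ _ (ℕ.≤-trans (ℕ.+-monoʳ-≤ (g Fin.zero) tails) Σg≤Σf))
    (Fin.suc i) → sum-mono-≤-tight (f≤g ∘ Fin.suc)
      (ℕ.+-cancelˡ-≤ _ _ _ (ℕ.≤-trans (ℕ.+-monoˡ-≤ _ (f≤g Fin.zero)) Σg≤Σf)) i
  where
  tails : sum (f ∘ Fin.suc) ≤ sum (g ∘ Fin.suc)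
  tails = sum-mono-≤ (f≤g ∘ Fin.suc)

𝟙 : ∀ {p} {P : Set p} → Dec P → ℕ
𝟙 (yes _) = 1
𝟙 (no  _) = 0

module _ {p q} {P : Set p} {Q : Set q} where

  𝟙-mono : (P? : Dec P) (Q? : Dec Q) → (P → Q) → 𝟙 P? ≤ 𝟙 Q?
  𝟙-mono (no  _) _       _ = z≤n
  𝟙-mono (yes _) (yes _) _ = ℕ.≤-refl
  𝟙-mono (yes p) (no ¬q) f = ⊥-elim (¬q (f p))

  𝟙-reflects : (P? : Dec P) (Q? : Dec Q) → 𝟙 P? ≡ 𝟙 Q? → P → Q
  𝟙-reflects _       (yes q) _ _ = q
  𝟙-reflects (no ¬p) (no _)  _ p = ⊥-elim (¬p p)

𝟙-cong : ∀ {p q} {P : Set p} {Q : Set q} (P? : Dec P) (Q? : Dec Q) →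
         (P → Q) → (Q → P) → 𝟙 P? ≡ 𝟙 Q?
𝟙-cong P? Q? f g = ℕ.≤-antisym (𝟙-mono P? Q? f) (𝟙-mono Q? P? g)

𝟙-yes : ∀ {p} {P : Set p} (P? : Dec P) → P → 𝟙 P? ≡ 1
𝟙-yes (yes _) _ = refl
𝟙-yes (no ¬p) p = ⊥-elim (¬p p)

𝟙-no : ∀ {p} {P : Set p} (P? : Dec P) → ¬ P → 𝟙 P? ≡ 0
𝟙-no (no _)  _  = refl
𝟙-no (yes p) ¬p = ⊥-elim (¬p p)

sum-select : ∀ {n} (j : Fin n) (f : Fin n → ℕ) →
             sum (λ i → 𝟙 (j ≟ i) ℕ.* f i) ≡ f j
sum-select {suc n} Fin.zero    f =
  trans (cong₂ ℕ._+_ (ℕ.*-identityˡ _) (trans (sum-const n 0) (ℕ.*-zeroʳ n)))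
        (ℕ.+-identityʳ _)
sum-select {suc n} (Fin.suc j) f =
  trans (sum-cong-≗ λ i → cong (ℕ._* f (Fin.suc i))
          (𝟙-cong (Fin.suc j ≟ Fin.suc i) (j ≟ i) (λ { refl → refl }) (cong Fin.suc)))
        (sum-select j (f ∘ Fin.suc))

-- Lengths of filtered lists as indicator sums.

module _ {a p} {A : Set a} {P : U.Pred A p} (P? : U.Decidable P) where

  length-filter-tabulate : ∀ {n} (f : Fin n → A) →
    length (filter P? (tabulate f)) ≡ sum (λ i → 𝟙 (P? (f i)))
  length-filter-tabulate {zero}  f = refl
  length-filter-tabulate {suc n} f with P? (f Fin.zero)
  ... | yes _ = cong suc (length-filter-tabulate (f ∘ Fin.suc))
  ... | no  _ = length-filter-tabulate (f ∘ Fin.suc)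

length-filter-cartesianProduct :
  ∀ {a b p} {A : Set a} {B : Set b} {P : U.Pred (A × B) p} (P? : U.Decidable P)
  {m n} (f : Fin m → A) (g : Fin n → B) →
  length (filter P? (cartesianProduct (tabulate f) (tabulate g)))
    ≡ sum (λ i → sum (λ j → 𝟙 (P? (f i , g j))))
length-filter-cartesianProduct P? {zero}  f g = refl
length-filter-cartesianProduct P? {suc m} f g = begin
  length (filter P? (row ++ rest))
    ≡⟨ cong length (filter-++ P? row rest) ⟩
  length (filter P? row ++ filter P? rest)
    ≡⟨ length-++ (filter P? row) ⟩
  length (filter P? row) ℕ.+ length (filter P? rest)
    ≡⟨ cong₂ ℕ._+_
         (trans (cong (length ∘ filter P?) (map-tabulate g (f Fin.zero ,_)))
                (length-filter-tabulate P? (λ j → f Fin.zero , g j)))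
         (length-filter-cartesianProduct P? (f ∘ Fin.suc) g) ⟩
  sum (λ i → sum (λ j → 𝟙 (P? (f i , g j)))) ∎
  where
  open ≡-Reasoning
  row  = map (f Fin.zero ,_) (tabulate g)
  rest = cartesianProduct (tabulate (f ∘ Fin.suc)) (tabulate g)

-- Class sizes and monochromatic pairs.

module _ {n r} (c : Fin n → Fin r) where

  classSize-sum : ∀ i → classSize c i ≡ sum (λ v → 𝟙 (c v ≟ i))
  classSize-sum i = length-filter-tabulate (λ v → c v ≟ i) id

  -- Double counting: once the sums over colours and vertices are interchanged, each vertex `v`
  -- selects the single colour `c v`.
  sum-classes : ∀ f → sum (λ i → classSize c i ℕ.* f i) ≡ sum (f ∘ c)
  sum-classes f = begin
    sum (λ i → classSize c i ℕ.* f i)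
      ≡⟨ sum-cong-≗ (λ i → trans (cong (ℕ._* f i) (classSize-sum i))
                                 (*-distribʳ-sum (f i) (λ v → 𝟙 (c v ≟ i)))) ⟩
    sum (λ i → sum (λ v → 𝟙 (c v ≟ i) ℕ.* f i))
      ≡⟨ ∑-comm (λ i v → 𝟙 (c v ≟ i) ℕ.* f i) ⟩
    sum (λ v → sum (λ i → 𝟙 (c v ≟ i) ℕ.* f i))
      ≡⟨ sum-cong-≗ (λ v → sum-select (c v) f) ⟩
    sum (f ∘ c) ∎
    where open ≡-Reasoning

  sum-classSize : sum (classSize c) ≡ n
  sum-classSize = begin
    sum (classSize c)               ≡⟨ sum-cong-≗ (λ i → ℕ.*-identityʳ (classSize c i)) ⟨
    sum (λ i → classSize c i ℕ.* 1) ≡⟨ sum-classes (λ _ → 1) ⟩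
    sum {n} (λ _ → 1)               ≡⟨ sum-const n 1 ⟩
    n ℕ.* 1                         ≡⟨ ℕ.*-identityʳ n ⟩
    n                               ∎
    where open ≡-Reasoning

  monochromaticPairs : ℕ
  monochromaticPairs = sum (λ u → sum (λ v → 𝟙 (c v ≟ c u)))

  -- The inner sum is the size of the class of `u`, so `sum-classes` applies with the class size
  -- itself as weight.
  monochromaticPairs-squares :
    monochromaticPairs ≡ sum (λ i → classSize c i ℕ.* classSize c i)
  monochromaticPairs-squares = begin
    monochromaticPairs
      ≡⟨ sum-cong-≗ (λ u → classSize-sum (c u)) ⟨
    sum (classSize c ∘ c)
      ≡⟨ sum-classes (classSize c) ⟨
    sum (λ i → classSize c i ℕ.* classSize c i) ∎
    where open ≡-Reasoning

-- Non-adjacent ordered pairs.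

module _ {n} (H : Graph n) where
  open Graph H

  nonAdjacentPairs : ℕ
  nonAdjacentPairs = sum (λ u → sum (λ v → 𝟙 (¬? (u ~? v))))

  -- Trichotomy splits the ordered pairs into the diagonal and two mirror halves, each counting the
  -- non-edges once. The extra `n` makes the right side twice that of the theorem's equation.
  nonAdjacentPairs-nonEdges :
    n ℕ.+ nonAdjacentPairs ≡ 2 ℕ.* (n ℕ.+ length (nonEdges H))
  nonAdjacentPairs-nonEdges = begin
    n ℕ.+ nonAdjacentPairs
      ≡⟨ cong (n ℕ.+_) (sum-cong-≗ λ u → sum-cong-≗ λ v → split u v) ⟩
    n ℕ.+ sum (λ u → sum (λ v → 𝟙 (u ≟ v) ℕ.* 1 ℕ.+ (e u v ℕ.+ e v u)))
      ≡⟨ cong (n ℕ.+_) (sum-cong-≗ λ u →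
           trans (∑-distrib-+ (λ v → 𝟙 (u ≟ v) ℕ.* 1) (λ v → e u v ℕ.+ e v u))
                 (cong₂ ℕ._+_ (sum-select u (λ _ → 1))
                              (∑-distrib-+ (e u) (λ v → e v u)))) ⟩
    n ℕ.+ sum (λ u → 1 ℕ.+ (sum (e u) ℕ.+ sum (λ v → e v u)))
      ≡⟨ cong (n ℕ.+_) (trans (∑-distrib-+ {n} (λ _ → 1) _)
           (cong₂ ℕ._+_ (trans (sum-const n 1) (ℕ.*-identityʳ n))
             (trans (∑-distrib-+ (λ u → sum (e u)) (λ u → sum (λ v → e v u)))
                    (cong (sum (λ u → sum (e u)) ℕ.+_) (∑-comm (λ u v → e v u)))))) ⟩
    n ℕ.+ (n ℕ.+ (sum (λ u → sum (e u)) ℕ.+ sum (λ u → sum (e u))))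
      ≡⟨ cong (λ m → n ℕ.+ (n ℕ.+ (m ℕ.+ m)))
           (length-filter-cartesianProduct
             (λ (u , v) → (u <? v) ×-dec ¬? (u ~? v)) id id) ⟨
    n ℕ.+ (n ℕ.+ (m′ ℕ.+ m′))
      ≡⟨ double n m′ ⟩
    2 ℕ.* (n ℕ.+ m′) ∎
    where
    open ≡-Reasoning

    m′ = length (nonEdges H)

    e : Fin n → Fin n → ℕ
    e u v = 𝟙 ((u <? v) ×-dec ¬? (u ~? v))

    e-< : ∀ {u v} → u Fin.< v → e u v ≡ 𝟙 (¬? (u ~? v))
    e-< {u} {v} u<v =
      𝟙-cong ((u <? v) ×-dec ¬? (u ~? v)) (¬? (u ~? v)) proj₂ (u<v ,_)

    e-≮ : ∀ {u v} → ¬ u Fin.< v → e u v ≡ 0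
    e-≮ {u} {v} u≮v = 𝟙-no ((u <? v) ×-dec ¬? (u ~? v)) (u≮v ∘ proj₁)

    split : ∀ u v → 𝟙 (¬? (u ~? v)) ≡ 𝟙 (u ≟ v) ℕ.* 1 ℕ.+ (e u v ℕ.+ e v u)
    split u v with <-cmp u v
    ... | tri< u<v u≢v v≮u
      rewrite 𝟙-no (u ≟ v) u≢v | e-< u<v | e-≮ v≮u = sym (ℕ.+-identityʳ _)
    ... | tri≈ u≮v refl _
      rewrite 𝟙-yes (u ≟ u) refl | e-≮ u≮v = 𝟙-yes (¬? (u ~? u)) (~-irr refl)
    ... | tri> u≮v u≢v v<u
      rewrite 𝟙-no (u ≟ v) u≢v | e-< v<u | e-≮ u≮v =
      𝟙-cong (¬? (u ~? v)) (¬? (v ~? u)) (_∘ ~-sym) (_∘ ~-sym)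

    double : ∀ n m → n ℕ.+ (n ℕ.+ (m ℕ.+ m)) ≡ 2 ℕ.* (n ℕ.+ m)
    double = ℕ.solve-∀

-- A quadratic bound for one class size.

-- (a − k)(a − k − 1) = e (e + 1), expanded without subtraction.
tangent : ∀ a k → ∃[ e ] (k ≡ a ℕ.+ e ⊎ a ≡ suc k ℕ.+ e) ×
  a ℕ.* a ℕ.+ a ℕ.+ suc k ℕ.* k ≡ a ℕ.* (2 ℕ.* suc k) ℕ.+ e ℕ.* suc e
tangent a k with ℕ.≤-<-connex a k
... | inj₁ a≤k with e , refl ← ℕ.m≤n⇒∃[o]m+o≡n a≤k = e , inj₁ refl , below a e
  where
  below : ∀ a e → a ℕ.* a ℕ.+ a ℕ.+ (1 ℕ.+ (a ℕ.+ e)) ℕ.* (a ℕ.+ e)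
                ≡ a ℕ.* (2 ℕ.* (1 ℕ.+ (a ℕ.+ e))) ℕ.+ e ℕ.* (1 ℕ.+ e)
  below = ℕ.solve-∀
... | inj₂ k<a with e , refl ← ℕ.m≤n⇒∃[o]m+o≡n k<a = e , inj₂ refl , above k e
  where
  above : ∀ k e → let a = 1 ℕ.+ k ℕ.+ e in
    a ℕ.* a ℕ.+ a ℕ.+ (1 ℕ.+ k) ℕ.* k ≡ a ℕ.* (2 ℕ.* (1 ℕ.+ k)) ℕ.+ e ℕ.* (1 ℕ.+ e)
  above = ℕ.solve-∀

tangent-≤ : ∀ a k → a ℕ.* (2 ℕ.* suc k) ≤ a ℕ.* a ℕ.+ a ℕ.+ suc k ℕ.* k
tangent-≤ a k with e , _ , eq ← tangent a k = ℕ.m+n≤o⇒m≤o _ (ℕ.≤-reflexive (sym eq))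

-- The defect `e * (1 + e)` in `tangent` vanishes only at `e = 0`, which leaves the two ends of the
-- interval from `k` to `k + 1`.
tangent-≡ : ∀ a k → a ℕ.* (2 ℕ.* suc k) ≡ a ℕ.* a ℕ.+ a ℕ.+ suc k ℕ.* k ⇔
                    (a ≡ k ⊎ a ≡ suc k)
tangent-≡ a k = mk⇔ to (λ where
    (inj₁ refl) → low a
    (inj₂ refl) → high k)
  where
  to : _ → a ≡ k ⊎ a ≡ suc k
  to tight with tangent a k
  ... | zero , inj₁ refl , _ = inj₁ (sym (ℕ.+-identityʳ a))
  ... | zero , inj₂ refl , _ = inj₂ (ℕ.+-identityʳ (suc k))
  ... | suc e , _ , eq = ⊥-elim (ℕ.m+1+n≢m (a ℕ.* (2 ℕ.* suc k)) (sym (trans tight eq)))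

  low : ∀ k → k ℕ.* (2 ℕ.* (1 ℕ.+ k)) ≡ k ℕ.* k ℕ.+ k ℕ.+ (1 ℕ.+ k) ℕ.* k
  low = ℕ.solve-∀

  high : ∀ k → (1 ℕ.+ k) ℕ.* (2 ℕ.* (1 ℕ.+ k))
             ≡ (1 ℕ.+ k) ℕ.* (1 ℕ.+ k) ℕ.+ (1 ℕ.+ k) ℕ.+ (1 ℕ.+ k) ℕ.* k
  high = ℕ.solve-∀

-- The counting inequality for a proper colouring.

module _ {n χ} (H : Graph n) (c : Fin n → Fin χ) (proper : ProperColouring H c) where
  open Graph H

  private
    mono⇒nonAdjacent : ∀ u v → 𝟙 (c v ≟ c u) ≤ 𝟙 (¬? (u ~? v))
    mono⇒nonAdjacent u v = 𝟙-mono (c v ≟ c u) (¬? (u ~? v))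
      λ cv≡cu u~v → proper u v u~v (sym cv≡cu)

  monochromaticPairs≤nonAdjacentPairs : monochromaticPairs c ≤ nonAdjacentPairs H
  monochromaticPairs≤nonAdjacentPairs =
    sum-mono-≤ λ u → sum-mono-≤ λ v → mono⇒nonAdjacent u v

  -- The two counts compare pair by pair. With the totals reversed, tightness passes first to each
  -- row `u` and then to each pair, so no non-adjacent pair has two colours.
  nonAdjacentPairs≤⇒multipartite : nonAdjacentPairs H ≤ monochromaticPairs c →
                                   ∀ u v → c u ≢ c v → u ~ v
  nonAdjacentPairs≤⇒multipartite N≤M u v cu≢cv = decidable-stable (u ~? v)
    λ u≁v → cu≢cv (sym (𝟙-reflects (¬? (u ~? v)) (c v ≟ c u)
      (sym (sum-mono-≤-tight (mono⇒nonAdjacent u) (ℕ.≤-reflexive (sym rows)) v)) u≁v))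
    where
    rows = sum-mono-≤-tight (λ u → sum-mono-≤ (mono⇒nonAdjacent u)) N≤M u

  multipartite⇒nonAdjacentPairs : (∀ u v → c u ≢ c v → u ~ v) →
                                  nonAdjacentPairs H ≡ monochromaticPairs c
  multipartite⇒nonAdjacentPairs complete =
    sum-cong-≗ λ u → sum-cong-≗ λ v → 𝟙-cong (¬? (u ~? v)) (c v ≟ c u)
      (λ u≁v → sym (decidable-stable (c u ≟ c v) (u≁v ∘ complete u v)))
      (λ cv≡cu u~v → proper u v u~v (sym cv≡cu))

  -- Summing `tangent-≤` over the classes and then replacing monochromatic by non-adjacent pairs
  -- bounds the left side by the right in two steps. The equation holds exactly when both steps are
  -- tight.
  edgeCount⇔ : ∀ k →
    n ℕ.* (2 ℕ.* suc k) ≡ (nonAdjacentPairs H ℕ.+ n) ℕ.+ χ ℕ.* (suc k ℕ.* k) ⇔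
    ((∀ u v → c u ≢ c v → u ~ v) × (∀ i → classSize c i ≡ k ⊎ classSize c i ≡ suc k))
  edgeCount⇔ k = mk⇔ to from
    where
    a = classSize c

    lower upper : Fin χ → ℕ
    lower i = a i ℕ.* (2 ℕ.* suc k)
    upper i = a i ℕ.* a i ℕ.+ a i ℕ.+ suc k ℕ.* k

    sum-lower : sum lower ≡ n ℕ.* (2 ℕ.* suc k)
    sum-lower = trans (sym (*-distribʳ-sum (2 ℕ.* suc k) a))
                      (cong (ℕ._* (2 ℕ.* suc k)) (sum-classSize c))

    sum-upper : sum upper ≡ (monochromaticPairs c ℕ.+ n) ℕ.+ χ ℕ.* (suc k ℕ.* k)
    sum-upper = begin
      sum upper
        ≡⟨ ∑-distrib-+ (λ i → a i ℕ.* a i ℕ.+ a i) (λ _ → suc k ℕ.* k) ⟩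
      sum (λ i → a i ℕ.* a i ℕ.+ a i) ℕ.+ sum {χ} (λ _ → suc k ℕ.* k)
        ≡⟨ cong₂ ℕ._+_
             (trans (∑-distrib-+ (λ i → a i ℕ.* a i) a)
                    (cong₂ ℕ._+_ (sym (monochromaticPairs-squares c)) (sum-classSize c)))
             (sum-const χ (suc k ℕ.* k)) ⟩
      (monochromaticPairs c ℕ.+ n) ℕ.+ χ ℕ.* (suc k ℕ.* k) ∎
      where open ≡-Reasoning

    lower≤upper : ∀ i → lower i ≤ upper i
    lower≤upper i = tangent-≤ (a i) k

    to : _ → _
    to eq = nonAdjacentPairs≤⇒multipartite N≤M
          , λ i → Equivalence.to (tangent-≡ (a i) k)
                    (sum-mono-≤-tight lower≤upper Σupper≤Σlower i)
      where
      open ℕ.≤-Reasoning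
      N≤M : nonAdjacentPairs H ≤ monochromaticPairs c
      N≤M = ℕ.+-cancelʳ-≤ _ _ _ (ℕ.+-cancelʳ-≤ _ _ _ (begin
        (nonAdjacentPairs H ℕ.+ n) ℕ.+ χ ℕ.* (suc k ℕ.* k)   ≡⟨ trans sum-lower eq ⟨
        sum lower                                          ≤⟨ sum-mono-≤ lower≤upper ⟩
        sum upper                                          ≡⟨ sum-upper ⟩
        (monochromaticPairs c ℕ.+ n) ℕ.+ χ ℕ.* (suc k ℕ.* k) ∎))

      Σupper≤Σlower : sum upper ≤ sum lower
      Σupper≤Σlower = begin
        sum upper                                            ≡⟨ sum-upper ⟩
        (monochromaticPairs c ℕ.+ n) ℕ.+ χ ℕ.* (suc k ℕ.* k)
          ≤⟨ ℕ.+-monoˡ-≤ _ (ℕ.+-monoˡ-≤ n monochromaticPairs≤nonAdjacentPairs) ⟩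
        (nonAdjacentPairs H ℕ.+ n) ℕ.+ χ ℕ.* (suc k ℕ.* k)     ≡⟨ trans sum-lower eq ⟨
        sum lower                                            ∎

    from : _ → _
    from (complete , sizes) = begin
      n ℕ.* (2 ℕ.* suc k)
        ≡⟨ sum-lower ⟨
      sum lower
        ≡⟨ sum-cong-≗ (λ i → Equivalence.from (tangent-≡ (a i) k) (sizes i)) ⟩
      sum upper
        ≡⟨ sum-upper ⟩
      (monochromaticPairs c ℕ.+ n) ℕ.+ χ ℕ.* (suc k ℕ.* k)
        ≡⟨ cong (λ N → (N ℕ.+ n) ℕ.+ χ ℕ.* (suc k ℕ.* k))
                (multipartite⇒nonAdjacentPairs complete) ⟨
      (nonAdjacentPairs H ℕ.+ n) ℕ.+ χ ℕ.* (suc k ℕ.* k) ∎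
      where open ≡-Reasoning

-- Optimal colourings of multipartite graphs.

module _ {n χ} {H : Graph n} (least : Least (Colourable H) χ) where
  open Graph H

  everyColourUsed : ∀ {c : Fin n → Fin χ} → ProperColouring H c →
                    ∀ i → ∃[ v ] c v ≡ i
  everyColourUsed {c} proper i with any? (λ v → c v ≟ i)
  ... | yes used  = used
  ... | no unused = ⊥-elim (avoid least c proper i unused)
    where
    -- `χ` is quantified afresh so that it can be matched as a successor; the colour `i` excludes
    -- zero.
    avoid : ∀ {χ} → Least (Colourable H) χ → (c : Fin n → Fin χ) →
            ProperColouring H c → ∀ i → ¬ ¬ (∃[ v ] c v ≡ i)
    avoid {suc χ} (_ , minimal) c proper i unused =
      minimal χ ℕ.≤-refl ((λ v → punchOut (i≢c v)) ,
        λ u v u~v eq → proper u v u~v (punchOut-injective (i≢c u) (i≢c v) eq))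
      where
      i≢c : ∀ v → i ≢ c v
      i≢c v i≡cv = unused (v , sym i≡cv)

  -- If a part of H contained two colours, giving the whole part the first
  -- of them would free the second.
  part⇒colour : ∀ {r} {p : Fin n → Fin r} → (∀ u v → u ~ v ⇔ p u ≢ p v) →
                ∀ {c : Fin n → Fin χ} → ProperColouring H c →
                ∀ {u v} → p u ≡ p v → c u ≡ c v
  part⇒colour {p = p} adj {c} proper {u} {v} pu≡pv =
    decidable-stable (c u ≟ c v) λ cu≢cv →
      let w , eq = everyColourUsed c′-proper (c v) in c′≢cv cu≢cv w eq
    where
    c′ : Fin n → Fin χ
    c′ w with p w ≟ p u
    ... | yes _ = c u
    ... | no  _ = c w

    -- Vertices in different parts are adjacent, so no colour occurs in two parts.
    colour⇒part : ∀ {x y} → c x ≡ c y → p x ≡ p y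
    colour⇒part {x} {y} cx≡cy = decidable-stable (p x ≟ p y)
      λ px≢py → proper x y (Equivalence.from (adj x y) px≢py) cx≡cy

    c′-proper : ProperColouring H c′
    c′-proper x y x~y with p x ≟ p u | p y ≟ p u
    ... | yes px≡pu | yes py≡pu =
      λ _ → Equivalence.to (adj x y) x~y (trans px≡pu (sym py≡pu))
    -- An outside vertex with colour `c u` would have to lie in the part of `u`.
    ... | yes _     | no  py≢pu = λ eq → py≢pu (colour⇒part (sym eq))
    ... | no  px≢pu | yes _     = λ eq → px≢pu (colour⇒part eq)
    ... | no  _     | no  _     = proper x y x~y

    -- Only the common part of `u` and `v` can contain the colour `c v`, and `c′` has recoloured all
    -- of it.
    c′≢cv : c u ≢ c v → ∀ w → c′ w ≢ c v
    c′≢cv cu≢cv w eq with p w ≟ p u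
    ... | yes _     = cu≢cv eq
    ... | no  pw≢pu = pw≢pu (trans (colour⇒part eq) (sym pu≡pv))

-- Balanced class sizes and Turán graphs.

∣-∣≤1⇒≤ : ∀ {m n} → ∣ m - n ∣ ≤ 1 → m ≤ suc n
∣-∣≤1⇒≤ {m} {n} close = ℕ.≤-trans (ℕ.m≤n+∣m-n∣ m n)
  (ℕ.≤-trans (ℕ.+-monoʳ-≤ n close) (ℕ.≤-reflexive (ℕ.+-comm n 1)))

-- Averaging: a value below `k` keeps all values at most `k`, making the sum too small; a value
-- above `k + 1` keeps all at least `k + 1`, and the upper bound on the sum leaves no slack.
balanced-values : ∀ {r n k} (a : Fin r → ℕ) → (∀ i j → ∣ a i - a j ∣ ≤ 1) →
                  sum a ≡ n → k ℕ.* r < n → n ≤ suc k ℕ.* r →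
                  ∀ i → a i ≡ k ⊎ a i ≡ suc k
balanced-values {r} {n} {k} a close refl kr<n n≤[1+k]r i with ℕ.<-cmp (a i) k
... | tri≈ _ ai≡k _ = inj₁ ai≡k
... | tri< ai<k _ _ = ⊥-elim (ℕ.<⇒≱ kr<n (begin
    sum a             ≤⟨ sum-mono-≤ (λ j → ℕ.≤-trans (∣-∣≤1⇒≤ (close j i)) ai<k) ⟩
    sum {r} (λ _ → k) ≡⟨ sum-const r k ⟩
    r ℕ.* k           ≡⟨ ℕ.*-comm r k ⟩
    k ℕ.* r           ∎))
  where open ℕ.≤-Reasoning
... | tri> _ _ k<ai with ℕ.m≤n⇒m<n∨m≡n k<ai
...   | inj₂ eq     = inj₂ (sym eq)
-- Tightness yields `a i ≡ suc k`, which already is the conclusion, although the case is in fact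
-- contradictory.
...   | inj₁ 1+k<ai = inj₂ (sym (sum-mono-≤-tight
    (λ j → ℕ.s≤s⁻¹ (ℕ.≤-trans 1+k<ai (∣-∣≤1⇒≤ (close i j)))) (begin
      sum a                 ≤⟨ n≤[1+k]r ⟩
      suc k ℕ.* r           ≡⟨ ℕ.*-comm (suc k) r ⟩
      r ℕ.* suc k           ≡⟨ sum-const r (suc k) ⟨
      sum {r} (λ _ → suc k) ∎) i))
  where open ℕ.≤-Reasoning

consecutive-close : ∀ {k m n} → m ≡ k ⊎ m ≡ suc k → n ≡ k ⊎ n ≡ suc k → ∣ m - n ∣ ≤ 1
consecutive-close {k} (inj₁ refl) (inj₁ refl) rewrite ℕ.∣n-n∣≡0 k = z≤n
consecutive-close {k} (inj₂ refl) (inj₂ refl) rewrite ℕ.∣n-n∣≡0 k = z≤n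
consecutive-close {k} (inj₁ refl) (inj₂ refl)
  rewrite ℕ.m≤n⇒∣m-n∣≡n∸m (ℕ.n≤1+n k) = ℕ.≤-reflexive (ℕ.m+n∸n≡m 1 k)
consecutive-close {k} (inj₂ refl) (inj₁ refl)
  rewrite ℕ.m≤n⇒∣n-m∣≡n∸m (ℕ.n≤1+n k) = ℕ.≤-reflexive (ℕ.m+n∸n≡m 1 k)

-- Forwards, the colour classes serve as parts, with the identity as isomorphism. Backwards, the
-- colour classes are the preimages under `π` of the nonempty parts, so `c` inherits balance and
-- averaging fixes the sizes.
turán⇔ : ∀ {n χ k} {H : Graph n} → Least (Colourable H) χ →
         {c : Fin n → Fin χ} → ProperColouring H c →
         k ℕ.* χ < n → n ≤ suc k ℕ.* χ →
         ((∀ u v → c u ≢ c v → Graph._~_ H u v) ×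
          (∀ i → classSize c i ≡ k ⊎ classSize c i ≡ suc k))
         ⇔ IsTurán H
turán⇔ {n} {χ} {k} {H} least {c} proper kχ<n n≤[1+k]χ = mk⇔
  (λ (complete , sizes) → χ , c , (λ i j → consecutive-close (sizes i) (sizes j))
                        , Perm.id , λ u v → mk⇔ (proper u v) (complete u v))
  (λ (_ , p , balanced , π , adj) →
     let part⇒ : ∀ {u v} → p (π ⟨$⟩ʳ u) ≡ p (π ⟨$⟩ʳ v) → c u ≡ c v
         part⇒ = part⇒colour {H = H} least {p = λ u → p (π ⟨$⟩ʳ u)} adj {c} proper

         complete : ∀ u v → c u ≢ c v → u ~ v
         complete u v cu≢cv = Equivalence.from (adj u v) (cu≢cv ∘ part⇒)

         classSize-part : ∀ u → classSize c (c u) ≡ classSize p (p (π ⟨$⟩ʳ u))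
         classSize-part u = begin
           classSize c (c u)
             ≡⟨ classSize-sum c (c u) ⟩
           sum (λ v → 𝟙 (c v ≟ c u))
             ≡⟨ sum-cong-≗ (λ v → 𝟙-cong (c v ≟ c u) (p (π ⟨$⟩ʳ v) ≟ p (π ⟨$⟩ʳ u))
                  (λ cv≡cu → decidable-stable (_ ≟ _)
                     λ pv≢pu → proper v u (Equivalence.from (adj v u) pv≢pu) cv≡cu)
                  part⇒) ⟩
           sum (λ v → 𝟙 (p (π ⟨$⟩ʳ v) ≟ p (π ⟨$⟩ʳ u)))
             ≡⟨ ∑-permute (λ w → 𝟙 (p w ≟ p (π ⟨$⟩ʳ u))) π ⟨
           sum (λ w → 𝟙 (p w ≟ p (π ⟨$⟩ʳ u)))
             ≡⟨ classSize-sum p (p (π ⟨$⟩ʳ u)) ⟨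
           classSize p (p (π ⟨$⟩ʳ u)) ∎

         c-balanced : Balanced c
         -- Empty parts may make `r` differ from `χ`, so sizes are compared through a vertex of each
         -- colour.
         c-balanced i j =
           let u , cu≡i = everyColourUsed {H = H} least {c} proper i
               v , cv≡j = everyColourUsed {H = H} least {c} proper j
           in subst (_≤ 1)
                (cong₂ ∣_-_∣ (trans (sym (classSize-part u)) (cong (classSize c) cu≡i))
                             (trans (sym (classSize-part v)) (cong (classSize c) cv≡j)))
                (balanced _ _)
     in complete
      , balanced-values (classSize c) c-balanced (sum-classSize c) kχ<n n≤[1+k]χ)
  where
  open Graph H
  open ≡-Reasoning

-- Floors and ceilings of rational numbers.

-- The stored fraction of `q` is in lowest terms and may differ from `a / d`. Scaling the bounds by
-- both denominators lets the cross-multiplied equality link the two.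
floor-unique : ∀ q a d-1 w → toℚᵘ q ≃ mkℚᵘ a d-1 →
               w ℤ.* + suc d-1 ℤ.≤ a → a ℤ.< ℤ.suc w ℤ.* + suc d-1 → ℚ.floor q ≡ w
floor-unique q@(mkℚ num e-1 _) a d-1 w (*≡* num*d≡a*e) wd≤a a<[1+w]d =
  ℤ.≤-antisym (<suc⇒≤ f<1+w) (<suc⇒≤ w<1+f)
  where
  open ℤ.≤-Reasoning
  d = + suc d-1
  e = + suc e-1
  f = ℚ.floor q

  <suc⇒≤ : ∀ {i j} → i ℤ.< ℤ.suc j → i ℤ.≤ j
  <suc⇒≤ {i} {j} i<1+j = subst (i ℤ.≤_) (ℤ.pred-suc j) (ℤ.i<j⇒i≤pred[j] i<1+j)

  swap : ∀ x y z → x ℤ.* y ℤ.* z ≡ x ℤ.* z ℤ.* y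
  swap = ℤ.solve-∀

  f<1+w : f ℤ.< ℤ.suc w
  f<1+w = ℤ.*-cancelʳ-<-nonNeg e (ℤ.*-cancelʳ-<-nonNeg d (begin-strict
    f ℤ.* e ℤ.* d         ≤⟨ ℤ.*-monoʳ-≤-nonNeg d (ℤ.[n/d]*d≤n num e) ⟩
    num ℤ.* d             ≡⟨ num*d≡a*e ⟩
    a ℤ.* e               <⟨ ℤ.*-monoʳ-<-pos e a<[1+w]d ⟩
    ℤ.suc w ℤ.* d ℤ.* e   ≡⟨ swap (ℤ.suc w) d e ⟩
    ℤ.suc w ℤ.* e ℤ.* d   ∎))

  num<[1+f]e : num ℤ.< ℤ.suc f ℤ.* e
  num<[1+f]e = subst (λ g → num ℤ.< ℤ.suc g ℤ.* e)
    (sym (ℤ.div-pos-is-/ℕ num (suc e-1))) (ℤ.n<s[n/ℕd]*d num (suc e-1))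

  w<1+f : w ℤ.< ℤ.suc f
  w<1+f = ℤ.*-cancelʳ-<-nonNeg d (ℤ.*-cancelʳ-<-nonNeg e (begin-strict
    w ℤ.* d ℤ.* e         ≤⟨ ℤ.*-monoʳ-≤-nonNeg e wd≤a ⟩
    a ℤ.* e               ≡⟨ num*d≡a*e ⟨
    num ℤ.* d             <⟨ ℤ.*-monoʳ-<-pos d num<[1+f]e ⟩
    ℤ.suc f ℤ.* e ℤ.* d   ≡⟨ swap (ℤ.suc f) e d ⟩
    ℤ.suc f ℤ.* d ℤ.* e   ∎))

-- `ceiling` is the negated floor of the negative, so the bounds are negated and passed to
-- `floor-unique`.
ceiling-unique : ∀ p a d-1 z → toℚᵘ p ≃ mkℚᵘ a d-1 →
                 ℤ.pred z ℤ.* + suc d-1 ℤ.< a → a ℤ.≤ z ℤ.* + suc d-1 → ceiling p ≡ z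
-- The match on `record{}` lets `ceiling p` unfold.
ceiling-unique p@record{} a d-1 z p≃a/d [z-1]d<a a≤zd =
  trans (cong ℤ.-_ (floor-unique (- p) (ℤ.- a) d-1 (ℤ.- z)
          (ℚᵘ.≃-trans (ℚ.toℚᵘ-homo‿- p) (ℚᵘ.-‿cong p≃a/d))
          (subst (ℤ._≤ ℤ.- a) (neg-* z d) (ℤ.neg-mono-≤ a≤zd))
          (subst (ℤ.- a ℤ.<_) (neg-pred-* z d) (ℤ.neg-mono-< [z-1]d<a))))
        (ℤ.neg-involutive z)
  where
  d = + suc d-1

  neg-* : ∀ z d → ℤ.- (z ℤ.* d) ≡ ℤ.- z ℤ.* d
  neg-* = ℤ.solve-∀

  neg-pred-* : ∀ z d → ℤ.- ((ℤ.- (+ 1) ℤ.+ z) ℤ.* d) ≡ (+ 1 ℤ.+ ℤ.- z) ℤ.* d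
  neg-pred-* = ℤ.solve-∀

toℚᵘ-/ : ∀ i d-1 → toℚᵘ (i / suc d-1) ≃ mkℚᵘ i d-1
toℚᵘ-/ i d-1 = ℚ.toℚᵘ-fromℚᵘ (mkℚᵘ i d-1)

module _ {p q x y} (p≃x : toℚᵘ p ≃ x) (q≃y : toℚᵘ q ≃ y) where

  toℚᵘ-+ : toℚᵘ (p + q) ≃ x ℚᵘ.+ y
  toℚᵘ-+ = ℚᵘ.≃-trans (ℚ.toℚᵘ-homo-+ p q) (ℚᵘ.+-cong p≃x q≃y)

  toℚᵘ-* : toℚᵘ (p * q) ≃ x ℚᵘ.* y
  toℚᵘ-* = ℚᵘ.≃-trans (ℚ.toℚᵘ-homo-* p q) (ℚᵘ.*-cong p≃x q≃y)

toℚᵘ‿- : ∀ {p x} → toℚᵘ p ≃ x → toℚᵘ (- p) ≃ ℚᵘ.- x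
toℚᵘ‿- {p} p≃x = ℚᵘ.≃-trans (ℚ.toℚᵘ-homo‿- p) (ℚᵘ.-‿cong p≃x)

pos-*-< : ∀ {m n o} → m ℕ.* n < o → + m ℤ.* + n ℤ.< + o
pos-*-< {m} {n} {o} mn<o = subst (ℤ._< + o) (ℤ.pos-* m n) (ℤ.+<+ mn<o)

pos-≤-* : ∀ {m n o} → o ≤ m ℕ.* n → + o ℤ.≤ + m ℤ.* + n
pos-≤-* {m} {n} {o} o≤mn = subst (+ o ℤ.≤_) (ℤ.pos-* m n) (ℤ.+≤+ o≤mn)

ceiling-/ : ∀ {n d k} .{{_ : NonZero d}} → k ℕ.* d < n → n ≤ suc k ℕ.* d →
            ceiling (+ n / d) ≡ + suc k
ceiling-/ {n} {suc d-1} {k} kd<n n≤[1+k]d =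
  ceiling-unique (+ n / suc d-1) (+ n) d-1 (+ suc k) (toℚᵘ-/ (+ n) d-1)
                 (pos-*-< {k} kd<n) (pos-≤-* {suc k} n≤[1+k]d)

ceiling-/-1 : ∀ {n d k} .{{_ : NonZero d}} → k ℕ.* d < n → n ≤ suc k ℕ.* d →
              ceiling ((+ n / d) - 1ℚ) ≡ + k
ceiling-/-1 {n} {d@(suc d-1)} {k} kd<n n≤[1+k]d =
  -- Represented as `(n - d) / d`, the number gets both its bounds from those on `n` by subtracting
  -- `d`.
  ceiling-unique ((+ n / d) - 1ℚ) (+ n ℤ.- + d) d-1 (+ k)
    (ℚᵘ.≃-trans (toℚᵘ-+ {+ n / d} { - 1ℚ} (toℚᵘ-/ (+ n) d-1) ℚᵘ.≃-refl)
                (*≡* (cross (+ n) (+ d))))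
    (subst (ℤ._< + n ℤ.- + d) (lower (+ k) (+ d))
           (ℤ.+-monoˡ-< (ℤ.- + d) (pos-*-< {k} kd<n)))
    (subst (+ n ℤ.- + d ℤ.≤_) (upper (+ k) (+ d))
           (ℤ.+-monoˡ-≤ (ℤ.- + d) (pos-≤-* {suc k} n≤[1+k]d)))
  where
  lower : ∀ k d → k ℤ.* d ℤ.- d ≡ (ℤ.- (+ 1) ℤ.+ k) ℤ.* d
  lower = ℤ.solve-∀

  upper : ∀ k d → (+ 1 ℤ.+ k) ℤ.* d ℤ.- d ≡ k ℤ.* d
  upper = ℤ.solve-∀

  cross : ∀ n d → (n ℤ.* + 1 ℤ.+ ℤ.- (+ 1) ℤ.* d) ℤ.* d ≡ (n ℤ.- d) ℤ.* (d ℤ.* + 1)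
  cross = ℤ.solve-∀

-- Clearing denominators.

-- Twice the rational equation, with the negative term moved across so that it can be stated in `ℕ`.
-- The ceilings enter as `x` and `y`, so that matching `refl` replaces them by naturals.
rationalEquation⇔ : ∀ n χ m s k {x y} → x ≡ + s → y ≡ + k →
  (x / 1) * ((+ n / 1) - (+ χ / 2) * (y / 1)) ≡ (+ n / 1) + (+ m / 1) ⇔
  n ℕ.* (2 ℕ.* s) ≡ 2 ℕ.* (n ℕ.+ m) ℕ.+ χ ℕ.* (s ℕ.* k)
rationalEquation⇔ n χ m s k refl refl = mk⇔
  (λ eq → cast (ℚᵘ.≃-trans (ℚᵘ.≃-sym lhs≃) (ℚᵘ.≃-trans (ℚ.toℚᵘ-cong eq) rhs≃)))
  (λ eq → ℚ.toℚᵘ-injective (ℚᵘ.≃-trans lhs≃ (ℚᵘ.≃-trans (uncast eq) (ℚᵘ.≃-sym rhs≃))))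
  where
  lhs rhs : ℚᵘ
  lhs = mkℚᵘ (+ s) 0 ℚᵘ.* (mkℚᵘ (+ n) 0 ℚᵘ.- mkℚᵘ (+ χ) 1 ℚᵘ.* mkℚᵘ (+ k) 0)
  rhs = mkℚᵘ (+ n) 0 ℚᵘ.+ mkℚᵘ (+ m) 0

  lhs≃ : toℚᵘ ((+ s / 1) * ((+ n / 1) - (+ χ / 2) * (+ k / 1))) ≃ lhs
  lhs≃ = toℚᵘ-* {+ s / 1} (toℚᵘ-/ (+ s) 0) (toℚᵘ-+ {+ n / 1} (toℚᵘ-/ (+ n) 0)
    (toℚᵘ‿- {(+ χ / 2) * (+ k / 1)}
      (toℚᵘ-* {+ χ / 2} {+ k / 1} (toℚᵘ-/ (+ χ) 1) (toℚᵘ-/ (+ k) 0))))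

  rhs≃ : toℚᵘ ((+ n / 1) + (+ m / 1)) ≃ rhs
  rhs≃ = toℚᵘ-+ {+ n / 1} {+ m / 1} (toℚᵘ-/ (+ n) 0) (toℚᵘ-/ (+ m) 0)

  L R : ℤ
  L = ℚᵘ.↥ lhs ℤ.* ℚᵘ.↧ rhs
  R = ℚᵘ.↥ rhs ℤ.* ℚᵘ.↧ lhs

  -- `L` amounts to `s * (2 * n - χ * k)`; adding `χ * s * k` leaves the cast of a natural number.
  corr : ℤ
  corr = + χ ℤ.* (+ s ℤ.* + k)

  L+corr : + (n ℕ.* (2 ℕ.* s)) ≡ L ℤ.+ corr
  L+corr = trans (trans (ℤ.pos-* n (2 ℕ.* s)) (cong (+ n ℤ.*_) (ℤ.pos-* 2 s)))
                 (expand (+ s) (+ n) (+ χ) (+ k))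
    where
    expand : ∀ s n χ k → n ℤ.* (+ 2 ℤ.* s) ≡
      s ℤ.* (n ℤ.* + 2 ℤ.+ ℤ.- (χ ℤ.* k) ℤ.* + 1) ℤ.* + 1 ℤ.+ χ ℤ.* (s ℤ.* k)
    expand = ℤ.solve-∀

  R+corr : + (2 ℕ.* (n ℕ.+ m) ℕ.+ χ ℕ.* (s ℕ.* k)) ≡ R ℤ.+ corr
  R+corr = trans (cong₂ ℤ._+_
      (trans (ℤ.pos-* 2 (n ℕ.+ m)) (expand (+ n) (+ m)))
      (trans (ℤ.pos-* χ (s ℕ.* k)) (cong (+ χ ℤ.*_) (ℤ.pos-* s k)))) refl
    where
    expand : ∀ n m → + 2 ℤ.* (n ℤ.+ m) ≡ (n ℤ.* + 1 ℤ.+ m ℤ.* + 1) ℤ.* + 2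
    expand = ℤ.solve-∀

  cast : lhs ≃ rhs → n ℕ.* (2 ℕ.* s) ≡ 2 ℕ.* (n ℕ.+ m) ℕ.+ χ ℕ.* (s ℕ.* k)
  cast (*≡* L≡R) =
    ℤ.+-injective (trans L+corr (trans (cong (ℤ._+ corr) L≡R) (sym R+corr)))

  uncast : n ℕ.* (2 ℕ.* s) ≡ 2 ℕ.* (n ℕ.+ m) ℕ.+ χ ℕ.* (s ℕ.* k) → lhs ≃ rhs
  uncast eq = *≡* (∙-cancelʳ corr L R (trans (sym L+corr) (trans (cong +_ eq) R+corr)))

-- From the equation to Turán graphs.

-- For positive `n`, the ceiling of `n / χ` is one more than the floor of `(n - 1) / χ`; the pattern
-- `suc n` supplies the predecessor.
ceiling-bounds : ∀ n χ .{{_ : NonZero n}} .{{_ : NonZero χ}} →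
                 ∃[ k ] k ℕ.* χ < n × n ≤ suc k ℕ.* χ
ceiling-bounds (suc n) χ = n ℕ./ χ , s≤s (ℕ.m/n*n≤m n χ) , (begin-strict
  n                               ≡⟨ ℕ.m≡m%n+[m/n]*n n χ ⟩
  n ℕ.% χ ℕ.+ (n ℕ./ χ) ℕ.* χ     <⟨ ℕ.+-monoˡ-< _ (ℕ.m%n<n n χ) ⟩
  suc (n ℕ./ χ) ℕ.* χ             ∎)
  where open ℕ.≤-Reasoning

-- Four equivalences are chained: from rationals to naturals, from `2 * (n + m′)` to `N + n`, from
-- the count to completeness and class sizes, and from these to a Turán graph. Stating this for any
-- least `χ` keeps `chromaticNumber` opaque.
leastColouring⇒equation⇔turán :
  ∀ n χ .{{_ : NonZero n}} .{{_ : NonZero χ}} (H : Graph n) → Least (Colourable H) χ →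
  (⌈ + n / χ ⌉ / 1) * ((+ n / 1) - (+ χ / 2) * (⌈ (+ n / χ) - 1ℚ ⌉ / 1))
    ≡ (+ n / 1) + (+ length (nonEdges H) / 1)
  ⇔ IsTurán H
leastColouring⇒equation⇔turán n χ H optimal@((c , proper) , _) =
  let k , kχ<n , n≤[1+k]χ = ceiling-bounds n χ
      count = cong (ℕ._+ χ ℕ.* (suc k ℕ.* k))
                (trans (sym (nonAdjacentPairs-nonEdges H)) (ℕ.+-comm n (nonAdjacentPairs H)))
  in
  turán⇔ {H = H} optimal {c} proper kχ<n n≤[1+k]χ
    ⇔-∘ (edgeCount⇔ H c proper k
    ⇔-∘ (mk⇔ (λ eq → trans eq count) (λ eq → trans eq (sym count))
    ⇔-∘ rationalEquation⇔ n χ (length (nonEdges H)) (suc k) k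
          (ceiling-/ kχ<n n≤[1+k]χ) (ceiling-/-1 kχ<n n≤[1+k]χ)))

theorem1p2 :
    (n : ℕ) .{{_ : NonZero n}} (H : Graph n) →
    let χ  = chromaticNumber H
        m′ = length (nonEdges H)
    in
    ( (⌈ + n / χ ⌉ / 1) * ((+ n / 1) - (+ χ / 2) * (⌈ (+ n / χ) - 1ℚ ⌉ / 1))
        ≡ (+ n / 1) + (+ m′ / 1) )
    ⇔ IsTurán H
theorem1p2 n H = leastColouring⇒equation⇔turán n (chromaticNumber H)
  {{it}} {{chromaticNumber-nonZero {H = H}}} H (chromaticNumber-least H)
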